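{- Let $F=\{F_n\}_{n\ge 0}$ be an arbitrary sequence of natural numbers with $F_0=1$ (the value $F_0=0$ being allowed exceptionally), and let $\Pi$ be the cobweb poset uniquely designated by $F$. Then the numbers $F_n$ ($n\ge 0$) are the incidence coefficients in the standard reduced incidence algebra $R(\Pi)$ of $\Pi$; that is, for all $k,l,n\in\mathbb{N}_0$ with $k\le l\le n$, $$\left\langle {k,\,n \atop l}\right\rangle = F_l .$$
   Context: $\mathbb{N}_0=\mathbb{N}\cup\{0\}$. Cobweb poset: for $s\in\mathbb{N}_0$ let $\Phi_s=\{\langle j,s\rangle : 1\le j\le F_s\}$ (in the exceptional case $F_0=0$, the level $\Phi_0$ is a one-element set consisting of an empty root). The cobweb poset designated by $F$ is $\Pi=(V,\le)$ with $V=\bigcup_{s\ge 0}\Phi_s$ and, for $x=\langle s,t\rangle$, $y=\langle u,v\rangle$: $x\le y$ iff $t<v$ or ($t=v$ and $s=u$). The rank function is $r(x)=s$ for $x\in\Phi_s$. For $x\le y$ the segment is $[x,y]=\{z\in\Pi: x\le z\le y\}$; $S(\Pi)$ is the set of all segments. $I(\Pi)$ is the incidence algebra of $\Pi$ over an associative ring with identity (functions $f(x,y)$ vanishing unless $x\le y$, with product $(f\ast g)(x,y)=\sum_{x\le z\le y}f(x,z)g(z,y)$). The standard reduced incidence algebra $R(\Pi)$ is the algebra of those $f\in I(\Pi)$ which take equal values on isomorphic segments. For $k\le n$ the type $(k,n)$ is $(k,n)=\{[x,y]\in S(\Pi): r(x)=k,\ r(y)=n\}$, and $(k,n)=\emptyset$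 for $k>n$. For $[x,y]\in(k,n)$ and $l\in\mathbb{N}_0$ the incidence coefficient in $R(\Pi)$ is $$\left\langle {k,\,n \atop l}\right\rangle=\bigl|\{z\in[x,y] : [x,z]\in(k,l)\ \text{and}\ [z,y]\in(l,n)\}\bigr|.$$
   Formalization: The equation with F_l is proved for k < l < n; for l = k or l = n the coefficient is shown to be 1, since only an endpoint of the segment is counted, so the printed formula fails there unless F_l = 1 (e.g. k = l = n = 1, F_1 = 2). -}

module Defs where

open import Data.Fin using (Fin; toℕ)
open import Data.Fin.Properties using (toℕ-injective)
open import Data.Nat using (ℕ; zero; suc; _<_)
open import Data.Nat.Properties using (<-trans; <-irrefl)
open import Data.Product using (_×_; _,_; Σ-syntax; ∃-syntax)
open import Data.Refinement using (Refinement-syntax)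
open import Data.Sum using (_⊎_; inj₁; inj₂)
open import Function.Bundles using (_↔_)
open import Level using (0ℓ)
open import Relation.Binary.Bundles using (Poset)
open import Relation.Binary.PropositionalEquality
  using (_≡_; refl; sym; trans; isEquivalence)
open import Relation.Nullary using (contradiction)

-- When F 0 = 0 the bottom level still consists of a single (empty) root.
rootSize : ℕ → ℕ
rootSize zero    = 1
rootSize (suc m) = suc m

levelSize : (ℕ → ℕ) → ℕ → ℕ
levelSize F zero    = rootSize (F 0)
levelSize F (suc s) = F (suc s)

module Cobweb (F : ℕ → ℕ) where

  -- The vertex ⟨ j , s ⟩ with 1 ≤ j ≤ |Φₛ| is vertex s (j − 1).
  record Vertex : Set where
    constructor vertex
    field
      rank  : ℕ
      index : Fin (levelSize F rank)

  open Vertex public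

  infix 4 _⊑_
  _⊑_ : Vertex → Vertex → Set
  x ⊑ y = rank x < rank y ⊎ (rank x ≡ rank y × toℕ (index x) ≡ toℕ (index y))

  ⊑-reflexive : ∀ {x y} → x ≡ y → x ⊑ y
  ⊑-reflexive refl = inj₂ (refl , refl)

  ⊑-trans : ∀ {x y z} → x ⊑ y → y ⊑ z → x ⊑ z
  ⊑-trans (inj₁ p)          (inj₁ q)          = inj₁ (<-trans p q)
  ⊑-trans (inj₁ p)          (inj₂ (refl , _)) = inj₁ p
  ⊑-trans (inj₂ (refl , _)) (inj₁ q)          = inj₁ q
  ⊑-trans (inj₂ (p , i))    (inj₂ (q , j))    = inj₂ (trans p q , trans i j)

  ⊑-antisym : ∀ {x y} → x ⊑ y → y ⊑ x → x ≡ y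
  ⊑-antisym (inj₁ p) (inj₁ q)       = contradiction (<-trans p q) (<-irrefl refl)
  ⊑-antisym (inj₁ p) (inj₂ (e , _)) = contradiction p (<-irrefl (sym e))
  ⊑-antisym (inj₂ (e , _)) (inj₁ q) = contradiction q (<-irrefl (sym e))
  ⊑-antisym {vertex _ i} {vertex _ j} (inj₂ (refl , e)) _
    with refl ← toℕ-injective e = refl

  cobwebPoset : Poset 0ℓ 0ℓ 0ℓ
  cobwebPoset = record
    { Carrier = Vertex
    ; _≈_     = _≡_
    ; _≤_     = _⊑_
    ; isPartialOrder = record
      { isPreorder = record
        { isEquivalence = isEquivalence
        ; reflexive     = ⊑-reflexive
        ; trans         = ⊑-trans
        }
      ; antisym = ⊑-antisym
      }
    }

  open Poset cobwebPoset using (_≤_)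

  record Segment : Set where
    constructor segment
    field
      lower upper : Vertex
      lower≤upper : lower ≤ upper

  open Segment public

  HasType : ℕ → ℕ → Segment → Set
  HasType k n s = rank (lower s) ≡ k × rank (upper s) ≡ n

  Between : ℕ → ℕ → ℕ → Segment → Vertex → Set
  Between k n l s z =
    Σ[ p ∈ lower s ≤ z ] Σ[ q ∈ z ≤ upper s ]
      (HasType k l (segment (lower s) z p) × HasType l n (segment z (upper s) q))

  -- The refinement type is proof-irrelevant, so its elements are counted as
  -- vertices, regardless of how many proofs of membership there are.
  HasCardinality : (Vertex → Set) → ℕ → Set
  HasCardinality P c = [ z ∈ Vertex ∣ P z ] ↔ Fin c

  -- c is the incidence coefficient ⟨ k , n ; l ⟩: the count is c for every
  -- segment of type (k , n).  Requiring such a segment to exist makes c unique.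
  -- For l = k or l = n only an endpoint of the segment is counted, so c = 1 there
  -- whatever the size of the level l.
  IsIncidenceCoefficient : ℕ → ℕ → ℕ → ℕ → Set
  IsIncidenceCoefficient k n l c =
    (∃[ s ] HasType k n s) ×
    (∀ s → HasType k n s → HasCardinality (Between k n l s) c)

{-# OPTIONS --safe #-}
module Submission where

open import Defs
open import Data.Fin using (Fin; zero; toℕ; fromℕ<; cast)
open import Data.Fin.Properties using (toℕ-injective; toℕ-cast)
open import Data.Irrelevant using ([_])
open import Data.Nat using (ℕ; zero; suc; _≤_; _<_; z≤n; s≤s)
open import Data.Nat.Properties using (_≟_; <-irrefl; ≤-trans; m≤n⇒m<n∨m≡n)
open import Data.Product using (_×_; _,_; ∃-syntax)
open import Data.Refinement using (_,_)
open import Data.Refinement.Properties using (value-injective)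
open import Data.Sum using (_⊎_; inj₁; inj₂)
open import Function.Bundles using (mk↔ₛ′)
open import Relation.Binary.Definitions using (DecidableEquality)
open import Relation.Binary.PropositionalEquality using (_≡_; refl; sym; trans; cong)
open import Relation.Nullary using (yes; no; contradiction; recompute)

-- In the cobweb order, vertices of different ranks are always comparable, by rank alone, while
-- distinct vertices of equal rank never are. So for `k < l < n` the vertices counted in a segment
-- of type `(k , n)` form the whole level `l` (`level-cardinality`), of size `F l` because `l` is
-- positive. For `l = k` or `l = n` incomparability leaves just one endpoint
-- (`singleton-cardinality`). Nonempty levels supply a segment of each type.

module _ (F : ℕ → ℕ) where

  open Cobweb F

  vertex-≡ : ∀ {x y} → rank x ≡ rank y → toℕ (index x) ≡ toℕ (index y) → x ≡ y
  vertex-≡ r≡ i≡ = ⊑-antisym (inj₂ (r≡ , i≡)) (inj₂ (sym r≡ , sym i≡))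

  _≟ᵛ_ : DecidableEquality Vertex
  x ≟ᵛ y with rank x ≟ rank y | toℕ (index x) ≟ toℕ (index y)
  ... | yes r≡ | yes i≡ = yes (vertex-≡ r≡ i≡)
  ... | no  r≢ | _      = no λ { refl → r≢ refl }
  ... | yes _  | no i≢  = no λ { refl → i≢ refl }

  -- Each level is an antichain; this collapses the count at both ends of a segment.
  ⊑∧rank≡⇒≡ : ∀ {x y} → x ⊑ y → rank x ≡ rank y → x ≡ y
  ⊑∧rank≡⇒≡ (inj₁ r<)        r≡ = contradiction r< (<-irrefl r≡)
  ⊑∧rank≡⇒≡ (inj₂ (_ , i≡)) r≡ = vertex-≡ r≡ i≡

  singleton-cardinality : ∀ {P : Vertex → Set} v → P v → (∀ {z} → P z → z ≡ v) →
    HasCardinality P 1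
  singleton-cardinality v Pv unique = mk↔ₛ′ (λ _ → zero) (λ _ → v , [ Pv ])
    (λ { zero → refl })
    -- `Pz` is irrelevant here, so `unique Pz` is too; decidable equality of vertices turns it into
    -- a usable proof.
    (λ { (z , [ Pz ]) → value-injective (sym (recompute (z ≟ᵛ v) (unique Pz))) })

  -- The bijection reads off the index. `cast` accepts the irrelevant rank equation as it is; only
  -- the inverse law has to recover it, by deciding equality of ranks.
  level-cardinality : ∀ {P : Vertex → Set} l → (∀ {z} → P z → rank z ≡ l) →
    (∀ {z} → rank z ≡ l → P z) → HasCardinality P (levelSize F l)
  level-cardinality l P⇒rank rank⇒P = mk↔ₛ′
    (λ { (z , [ Pz ]) → cast (cong (levelSize F) (P⇒rank Pz)) (index z) })
    (λ i → vertex l i , [ rank⇒P refl ])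
    (λ i → toℕ-injective (toℕ-cast _ i))
    (λ { (z , [ Pz ]) → value-injective
      (vertex-≡ (sym (recompute (rank z ≟ l) (P⇒rank Pz))) (toℕ-cast _ (index z))) })

  Between⇒rank≡ : ∀ {k n l s z} → Between k n l s z → rank z ≡ l
  Between⇒rank≡ (_ , _ , (_ , z≡l) , _) = z≡l

  -- Strict rank inequalities on both sides make `z` comparable to both ends, whatever its index.
  rank≡⇒Between : ∀ {k n l s z} → k < l → l < n → HasType k n s → rank z ≡ l →
    Between k n l s z
  rank≡⇒Between k<l l<n (refl , refl) refl =
    inj₁ k<l , inj₁ l<n , (refl , refl) , (refl , refl)

  lower-cardinality : ∀ {k n} s → HasType k n s → HasCardinality (Between k n k s) 1
  lower-cardinality s (k≡ , n≡) = singleton-cardinality (lower s)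
    (⊑-reflexive refl , lower≤upper s , (k≡ , k≡) , (k≡ , n≡))
    (λ { (p , _ , (x≡k , z≡k) , _) → sym (⊑∧rank≡⇒≡ p (trans x≡k (sym z≡k))) })

  upper-cardinality : ∀ {k n} s → HasType k n s → HasCardinality (Between k n n s) 1
  upper-cardinality s (k≡ , n≡) = singleton-cardinality (upper s)
    (lower≤upper s , ⊑-reflexive refl , (k≡ , n≡) , (n≡ , n≡))
    (λ { (_ , q , _ , (z≡n , y≡n)) → ⊑∧rank≡⇒≡ q (trans z≡n (sym y≡n)) })

  levelSize>0 : (∀ n → 1 ≤ F (suc n)) → ∀ s → 0 < levelSize F s
  levelSize>0 F>0 (suc s) = F>0 s
  -- The root level is nonempty even for `F 0 = 0`, since `rootSize` turns 0 into 1.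
  levelSize>0 F>0 zero with F 0
  ... | zero  = s≤s z≤n
  ... | suc _ = s≤s z≤n

  -- Join the vertices of index 0 on the two levels: they are comparable by rank if `k < n`, and
  -- coincide if `k = n`.
  segment-exists : (∀ n → 1 ≤ F (suc n)) → ∀ {k n} → k ≤ n → ∃[ s ] HasType k n s
  segment-exists F>0 {k} {n} k≤n =
    segment (first k) (first n) (first-mono (m≤n⇒m<n∨m≡n k≤n)) , refl , refl
    where
    first : ℕ → Vertex
    first s = vertex s (fromℕ< (levelSize>0 F>0 s))

    first-mono : ∀ {s t} → s < t ⊎ s ≡ t → first s ⊑ first t
    first-mono (inj₁ s<t)  = inj₁ s<t
    first-mono (inj₂ refl) = ⊑-reflexive refl

theorem1 : (F : ℕ → ℕ) → (F 0 ≡ 1 ⊎ F 0 ≡ 0) → (∀ n → 1 ≤ F (suc n)) →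
    let open Cobweb F in
    ∀ k l n → k ≤ l → l ≤ n →
    (k < l → l < n → IsIncidenceCoefficient k n l (F l)) ×
    (l ≡ k ⊎ l ≡ n → IsIncidenceCoefficient k n l 1)
theorem1 F _ F>0 k l n k≤l l≤n = interior l , endpoint
  where
  open Cobweb F

  exists : ∃[ s ] HasType k n s
  exists = segment-exists F F>0 (≤-trans k≤l l≤n)

  interior : ∀ l → k < l → l < n → IsIncidenceCoefficient k n l (F l)
  -- `k < l` rules out `l = 0`, the only level where `levelSize` can differ from `F`; at `suc m` it
  -- reduces to `F (suc m)`.
  interior (suc m) k<l l<n = exists , λ s type →
    level-cardinality F (suc m) (Between⇒rank≡ F {s = s}) (rank≡⇒Between F {s = s} k<l l<n type)

  endpoint : l ≡ k ⊎ l ≡ n → IsIncidenceCoefficient k n l 1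
  endpoint (inj₁ refl) = exists , lower-cardinality F
  endpoint (inj₂ refl) = exists , upper-cardinality F
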